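{- Let $G=(V,E)$ be a graph which is an $n$-convex geometry with no star. Let $\mathcal{D}=\{x\in V:d(x)=|V|-2\}$ be the set of quasi-stars of $G$, and let $\operatorname{Max}(V)$ be the set of maximal elements of the neighbourhood poset $P(G)=(V,\leq)$, where $x\leq y$ if and only if $N[x]\subseteq N[y]$. Then $\mathcal{D}=\operatorname{Max}(V)$.
   Context: All graphs are finite, simple and undirected, with non-empty vertex set. $d(x)$ denotes the degree of the vertex $x$. For a graph $G=(V,E)$ and $x\in V$, the closed neighbourhood of $x$ is $N[x]=\{x\}\cup\{y\in V:\{x,y\}\in E\}$. A star of $G$ is a vertex $s$ with $N[s]=V$. For $Y\subseteq V$, the common closed neighbourhood is $N[Y]=\bigcap_{y\in Y}N[y]$ if $Y\neq\varnothing$, and $N[\varnothing]=V$. The neighbourhood convexity of $G$ is the family $n_G=\{N[Y]:Y\subseteq V\}\cup\{\varnothing\}$ of subsets of $V$; it contains $\varnothing$ and $V$ and is closed under intersection. Its members are called $n$-convex sets. For $X\subseteq V$ the convex hull $[X]_{n}$ is the intersection of all $n$-convex sets containing $X$. For an $n$-convex set $K$, $\operatorname{ex}(K)=\{x\in K: K\setminus\{x\}\in n_G\}$ is the set of extreme points of $K$. $G$ is an $n$-convex geometry if $K=[\operatorname{ex}(K)]_{n}$ for every $n$-convex set $K$. An element $x$ of $(V,\leq)$ is maximal if, for every $y\in V$, $x\leq y$ implies $y\leq x$. (The relation $\leq$ is in general a preorder; for an $n$-convex geometry it is a partial order.) -}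

module Defs where

open import Data.Fin.Base using (Fin)
open import Data.Fin.Subset using (Subset; _∈_; ⊥; ⊤; ⁅_⁆; _∪_; _-_; ⋂; ∣_∣; _⊆_)
open import Data.Fin.Subset.Properties using (_∈?_)
open import Data.List.Base using (allFin; filter; map)
open import Data.Nat.Base using (ℕ; _+_)
open import Data.Product.Base using (∃; _×_)
open import Data.Sum.Base using (_⊎_)
open import Data.Vec.Base using (tabulate)
open import Level using (0ℓ)
open import Relation.Binary.Core using (Rel)
open import Relation.Binary.Definitions using (Decidable; Irreflexive; Symmetric)
open import Relation.Binary.PropositionalEquality.Core using (_≡_)
open import Relation.Nullary.Decidable.Core using (does)
open import Relation.Unary using (Pred; _≐_)

record Graph (n : ℕ) : Set₁ where
  field
    Adj    : Rel (Fin n) 0ℓ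
    adj?   : Decidable Adj
    sym    : Symmetric Adj
    irrefl : Irreflexive _≡_ Adj

module _ {n : ℕ} (G : Graph n) where
  open Graph G

  neighbours : Fin n → Subset n
  neighbours x = tabulate (λ y → does (adj? x y))

  degree : Fin n → ℕ
  degree x = ∣ neighbours x ∣

  N : Fin n → Subset n
  N x = ⁅ x ⁆ ∪ neighbours x

  Star : Pred (Fin n) 0ℓ
  Star s = N s ≡ ⊤

  -- Written additively because n ∸ 2 would be 0, not -1, when n = 1.
  QuasiStar : Pred (Fin n) 0ℓ
  QuasiStar x = degree x + 2 ≡ n

  -- The intersection of the empty family is ⊤, so commonN ⊥ ≡ ⊤.
  commonN : Subset n → Subset n
  commonN Y = ⋂ (map N (filter (_∈? Y) (allFin n)))

  NConvex : Pred (Subset n) 0ℓ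
  NConvex K = (∃ λ Y → K ≡ commonN Y) ⊎ K ≡ ⊥

  hull : Pred (Fin n) 0ℓ → Pred (Fin n) 0ℓ
  hull X x = ∀ K → NConvex K → (∀ {y} → X y → y ∈ K) → x ∈ K

  ex : Subset n → Pred (Fin n) 0ℓ
  ex K x = x ∈ K × NConvex (K - x)

  IsNConvexGeometry : Set
  IsNConvexGeometry = ∀ K → NConvex K → (_∈ K) ≐ hull (ex K)

  infix 4 _≤ᴺ_
  _≤ᴺ_ : Rel (Fin n) 0ℓ
  x ≤ᴺ y = N x ⊆ N y

  Maximal : Pred (Fin n) 0ℓ
  Maximal x = ∀ y → x ≤ᴺ y → y ≤ᴺ x

{-# OPTIONS --safe #-}
-- Without stars, |N[x]| = |V| - 1 is the largest possible value, so quasi-stars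
-- are maximal. Conversely, if v is an extreme point of V, then V \ {v} is
-- n-convex, hence (as no vertex is a star) equal to N[y] for a single vertex y.
-- If x is maximal, then N[x] ≠ V, so N[x] cannot contain all the extreme points
-- of V, whose hull is V. For an extreme point v ∉ N[x], N[x] ⊆ V \ {v} = N[y],
-- and maximality forces N[x] = V \ {v}.
module Submission where

open import Defs
open import Data.Fin.Base using (Fin; zero; suc)
open import Data.Fin.Subset using (Subset; _∈_; _∉_; _⊆_; ⊥; ⊤; ⁅_⁆; _∪_; _-_; ⋂; ∣_∣; inside; outside)
open import Data.Fin.Subset.Properties
open import Data.List.Base using (List; []; _∷_; allFin)
open import Data.List.Membership.Propositional using () renaming (_∈_ to _∈ₗ_)
open import Data.List.Membership.Propositional.Properties using (∈-allFin; ∈-map∘filter⁺; ∈-map∘filter⁻)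
open import Data.List.Relation.Unary.Any using (here; there)
open import Data.Nat.Base using (ℕ; suc; NonZero; _+_; _≤_)
open import Data.Nat.Properties using (_≟_; +-comm; ≤-antisym)
open import Data.Product.Base using (∃; _×_; _,_; proj₁)
open import Data.Sum.Base using (inj₁; inj₂)
open import Data.Vec.Base using ([]; _∷_; here; there)
open import Data.Vec.Properties using ([]=⇒lookup; lookup∘tabulate)
open import Function.Base using (_∘_)
open import Relation.Binary.PropositionalEquality
  using (_≡_; refl; sym; trans; cong; subst; module ≡-Reasoning)
open import Relation.Nullary using (¬_; yes; no; contradiction)
open import Relation.Nullary.Decidable using (decidable-stable; dec-false)
open import Relation.Unary using (_≐_)

private
  variable
    n : ℕ
    x y : Fin n
    p : Subset n
    ps : List (Subset n)

∣⁅x⁆∪p∣≡1+∣p∣ : x ∉ p → ∣ ⁅ x ⁆ ∪ p ∣ ≡ suc ∣ p ∣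
∣⁅x⁆∪p∣≡1+∣p∣ {x = zero}  {inside  ∷ p} x∉p = contradiction here x∉p
∣⁅x⁆∪p∣≡1+∣p∣ {x = zero}  {outside ∷ p} x∉p = cong (suc ∘ ∣_∣) (∪-identityˡ p)
∣⁅x⁆∪p∣≡1+∣p∣ {x = suc x} {inside  ∷ p} x∉p = cong suc (∣⁅x⁆∪p∣≡1+∣p∣ (x∉p ∘ there))
∣⁅x⁆∪p∣≡1+∣p∣ {x = suc x} {outside ∷ p} x∉p = ∣⁅x⁆∪p∣≡1+∣p∣ (x∉p ∘ there)

1+∣p-x∣≡∣p∣ : x ∈ p → suc ∣ p - x ∣ ≡ ∣ p ∣
1+∣p-x∣≡∣p∣ {p = inside  ∷ p} here        = cong (suc ∘ ∣_∣) (p─⊥≡p p)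
1+∣p-x∣≡∣p∣ {p = inside  ∷ p} (there x∈p) = cong suc (1+∣p-x∣≡∣p∣ x∈p)
1+∣p-x∣≡∣p∣ {p = outside ∷ p} (there x∈p) = 1+∣p-x∣≡∣p∣ x∈p

-- If `x` survived its own removal, a second removal would shrink `p - x` strictly, yet removal is
-- idempotent.
x∉p-x : ∀ (p : Subset n) x → x ∉ p - x
x∉p-x p x x∈p-x = ⊂-irref (p─q─q≡p─q p ⁅ x ⁆) (x∈p⇒p-x⊂p x∈p-x)

x∉p⇒p⊆⊤-x : x ∉ p → p ⊆ ⊤ - x
x∉p⇒p⊆⊤-x {p = p} x∉p y∈p = x∈p∧x≢y⇒x∈p-y ∈⊤ λ y≡x → x∉p (subst (_∈ p) y≡x y∈p)

x∈⋂⁻ : x ∈ ⋂ ps → p ∈ₗ ps → x ∈ p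
x∈⋂⁻ {ps = q ∷ qs} x∈ (here refl) = p∩q⊆p q (⋂ qs) x∈
x∈⋂⁻ {ps = q ∷ qs} x∈ (there p∈)  = x∈⋂⁻ (p∩q⊆q q (⋂ qs) x∈) p∈

x∉⋂⁻ : x ∉ ⋂ ps → ∃ λ p → p ∈ₗ ps × x ∉ p
x∉⋂⁻ {ps = []} x∉ = contradiction ∈⊤ x∉
x∉⋂⁻ {x = x} {ps = p ∷ ps} x∉ with x ∈? p
... | no x∉p = p , here refl , x∉p
... | yes x∈p with x∉⋂⁻ {ps = ps} (λ x∈ → x∉ (x∈p∩q⁺ (x∈p , x∈)))
... | q , q∈ , x∉q = q , there q∈ , x∉q

module _ {n : ℕ} (G : Graph n) where
  open Graph G using (adj?; irrefl)

  x∉neighbours : ∀ x → x ∉ neighbours G x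
  -- The bit at `x` in the row of `x` is false by irreflexivity, while membership makes it true.
  x∉neighbours x x∈ with () ← trans (sym (dec-false (adj? x x) (irrefl refl)))
                                    (trans (sym (lookup∘tabulate _ x)) ([]=⇒lookup x∈))

  ∣N∣≡1+degree : ∀ x → ∣ N G x ∣ ≡ suc (degree G x)
  ∣N∣≡1+degree x = ∣⁅x⁆∪p∣≡1+∣p∣ (x∉neighbours x)

  -- The order compares closed neighbourhoods, so the degree condition is restated as |N[x]| = |V| -
  -- 1.
  quasiStar⇒∣N∣ : QuasiStar G x → suc ∣ N G x ∣ ≡ n
  quasiStar⇒∣N∣ {x} qs = trans (cong suc (∣N∣≡1+degree x)) (trans (+-comm 2 (degree G x)) qs)

  ∣N∣⇒quasiStar : suc ∣ N G x ∣ ≡ n → QuasiStar G x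
  ∣N∣⇒quasiStar {x} eq = trans (+-comm (degree G x) 2) (trans (cong suc (sym (∣N∣≡1+degree x))) eq)

  x∈N : ∀ x → x ∈ N G x
  x∈N x = p⊆p∪q (neighbours G x) (x∈⁅x⁆ x)

  commonN⊆N : ∀ {Y} → y ∈ Y → commonN G Y ⊆ N G y
  commonN⊆N {y} {Y} y∈Y x∈ =
    x∈⋂⁻ x∈ (∈-map∘filter⁺ (N G) (_∈? Y) (y , ∈-allFin y , refl , y∈Y))

  ∉commonN⁻ : ∀ {Y} → x ∉ commonN G Y → ∃ λ y → y ∈ Y × x ∉ N G y
  ∉commonN⁻ {Y = Y} x∉ with x∉⋂⁻ x∉
  ... | _ , p∈ , x∉p with ∈-map∘filter⁻ (N G) (_∈? Y) {xs = allFin n} p∈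
  ... | y , _ , refl , y∈Y = y , y∈Y , x∉p

  nconvex-⊤ : NConvex G ⊤
  nconvex-⊤ = inj₁ (⊥ , ⊆-antisym
    (λ {x} _ → decidable-stable (x ∈? _) λ x∉ → let _ , y∈⊥ , _ = ∉commonN⁻ x∉ in ∉⊥ y∈⊥)
    ⊆⊤)

  nconvex-N : ∀ x → NConvex G (N G x)
  nconvex-N x = inj₁ (⁅ x ⁆ , ⊆-antisym
    (λ {z} z∈N → decidable-stable (z ∈? _) λ z∉ →
      let y , y∈⁅x⁆ , z∉Ny = ∉commonN⁻ z∉ in
      z∉Ny (subst (λ v → z ∈ N G v) (sym (x∈⁅y⁆⇒x≡y x y∈⁅x⁆)) z∈N))
    (commonN⊆N (x∈⁅x⁆ x)))

  module _ (noStar : ∀ s → ¬ Star G s) where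

    -- Since `v` is missing from N[Y] = V - v, some y in Y has `v` outside N[y]. Then N[y] is
    -- squeezed: it contains N[Y] and is contained in V - v.
    ex-⊤⇒N : ∀ v → ex G ⊤ v → ∃ λ y → N G y ≡ ⊤ - v
    ex-⊤⇒N v (_ , inj₁ (Y , ⊤-v≡)) with ∉commonN⁻ (x∉p-x ⊤ v ∘ subst (v ∈_) (sym ⊤-v≡))
    ... | y , y∈Y , v∉Ny = y , ⊆-antisym (x∉p⇒p⊆⊤-x v∉Ny) (commonN⊆N y∈Y ∘ subst (_ ∈_) ⊤-v≡)
    -- If V - v is empty, then `v` is the only vertex and hence a star.
    ex-⊤⇒N v (_ , inj₂ ⊤-v≡⊥) = contradiction (⊆-antisym ⊆⊤ ⊤⊆N) (noStar v)
      where
      ⊤⊆N : ⊤ ⊆ N G v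
      ⊤⊆N {w} _ = decidable-stable (w ∈? _) λ w∉ →
        ∉⊥ (subst (w ∈_) ⊤-v≡⊥ (x∈p∧x≢y⇒x∈p-y ∈⊤ λ { refl → w∉ (x∈N v) }))

    quasiStar⇒maximal : QuasiStar G x → Maximal G x
    quasiStar⇒maximal {x} qs y x≤y {w} w∈Ny = decidable-stable (w ∈? N G x) λ w∉Nx →
      -- A vertex `w` of N[y] outside N[x] makes the inclusion strict, so |N[y]| is at least |N[x]|
      -- + 1 = n and `y` is a star.
      noStar y (∣p∣≡n⇒p≡⊤ (≤-antisym (∣p∣≤n (N G y))
        (subst (_≤ ∣ N G y ∣) (quasiStar⇒∣N∣ qs) (p⊂q⇒∣p∣<∣q∣ (x≤y , w , w∈Ny , w∉Nx)))))

    maximal∧ex∉N⇒quasiStar : ∀ {v} → Maximal G x → ex G ⊤ v → v ∉ N G x → QuasiStar G x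
    maximal∧ex∉N⇒quasiStar {x} {v} max v∈ex v∉Nx with ex-⊤⇒N v v∈ex
    ... | y , Ny≡⊤-v = ∣N∣⇒quasiStar (begin
      suc ∣ N G x ∣  ≡⟨ cong (suc ∘ ∣_∣) (⊆-antisym x≤y (max y x≤y)) ⟩
      suc ∣ N G y ∣  ≡⟨ cong (suc ∘ ∣_∣) Ny≡⊤-v ⟩
      suc ∣ ⊤ - v ∣  ≡⟨ 1+∣p-x∣≡∣p∣ {x = v} ∈⊤ ⟩
      ∣ ⊤ {n} ∣      ≡⟨ ∣⊤∣≡n n ⟩
      n              ∎)
      where
      open ≡-Reasoning
      x≤y : N G x ⊆ N G y
      x≤y = subst (_ ∈_) (sym Ny≡⊤-v) ∘ x∉p⇒p⊆⊤-x v∉Nx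

    maximal⇒quasiStar : IsNConvexGeometry G → Maximal G x → QuasiStar G x
    -- Equality of naturals is decidable, so one may argue by contradiction and never search for an
    -- extreme point outside N[x]: if `x` is not a quasi-star, all extreme points lie in N[x].
    maximal⇒quasiStar {x} geometry max = decidable-stable (degree G x + 2 ≟ n) λ ¬qs →
      noStar x (⊆-antisym ⊆⊤ λ w∈⊤ →
        -- Every vertex lies in the hull of the extreme points of V, hence in N[x], one of the
        -- n-convex sets being intersected.
        proj₁ (geometry ⊤ nconvex-⊤) w∈⊤ (N G x) (nconvex-N x) λ {v} v∈ex →
          decidable-stable (v ∈? N G x) (¬qs ∘ maximal∧ex∉N⇒quasiStar max v∈ex))

proposition30 : (n : ℕ) .{{_ : NonZero n}} (G : Graph n) →
    IsNConvexGeometry G →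
    (∀ s → ¬ Star G s) →
    QuasiStar G ≐ Maximal G
proposition30 n G geometry noStar =
  quasiStar⇒maximal G noStar , maximal⇒quasiStar G noStar geometry
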